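{- Let $\ell\ge 2$ be an integer, and let $G$ be a triangle-free graph with no $5$-hole and no odd hole of length more than $2\ell+1$. Then $\chi(G)\le (\ell+1)4^{\ell-1}$.
   Context: All graphs are finite, without loops or parallel edges. A hole in $G$ is an induced subgraph which is a cycle of length (number of edges) at least four; an $n$-hole is a hole of length $n$; an odd hole is a hole of odd length. $\chi(G)$ is the chromatic number of $G$. -}

module Defs where

open import Data.Fin using (Fin; toℕ; finToFun; funToFin)
open import Data.Fin.Properties using (any?; all?; finToFun-funToFin) renaming (_≟_ to _≟ᶠ_)
open import Data.Nat using (ℕ; zero; suc; _≤_; z≤n; s≤s)
open import Data.Nat.Divisibility using (_∣_)
open import Data.Product using (Σ-syntax; ∃-syntax; _×_; _,_; proj₁; proj₂)
open import Data.Sum using (_⊎_)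
open import Function using (id; _∘_)
open import Function.Bundles using (_⇔_)
open import Function.Definitions using (Injective)
open import Relation.Binary using (Rel; Symmetric; Irreflexive) renaming (Decidable to Decidable₂)
open import Relation.Binary.PropositionalEquality using (_≡_; refl; sym; trans)
open import Relation.Nullary using (¬_; Dec; yes; no; ¬?; _→-dec_; contradiction)
open import Relation.Nullary.Decidable using (map′)
open import Relation.Unary using (Pred; Decidable)
open import Level using (0ℓ)

-- Adjacency carries a decision procedure so that finite graphs behave as
-- they do classically.
record Graph (n : ℕ) : Set₁ where
  field
    _~_    : Rel (Fin n) 0ℓ
    ~-sym  : Symmetric _~_
    ~-irr  : Irreflexive _≡_ _~_
    _~?_   : Decidable₂ _~_

TriangleFree : ∀ {n} → Graph n → Set
TriangleFree G = ∀ u v w → ¬ (u ~ v × v ~ w × u ~ w)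
  where open Graph G

Next : (k : ℕ) → Fin k → Fin k → Set
Next k i j = toℕ j ≡ suc (toℕ i) ⊎ (suc (toℕ i) ≡ k × toℕ j ≡ 0)

-- Adjacency in the cycle 0, 1, …, k-1, 0; this is a k-edge simple cycle
-- only when k is at least 3.
CycleAdjacent : (k : ℕ) → Fin k → Fin k → Set
CycleAdjacent k i j = Next k i j ⊎ Next k j i

-- The hole is the subgraph induced on the image of c; the equivalence
-- (rather than an implication) says that the cycle has no chord.
Hole : ∀ {n} → Graph n → ℕ → Set
Hole {n} G k =
  4 ≤ k ×
  (Σ[ c ∈ (Fin k → Fin n) ]
     Injective _≡_ _≡_ c × (∀ i j → (c i ~ c j) ⇔ CycleAdjacent k i j))
  where open Graph G

Odd : ℕ → Set
Odd k = ¬ (2 ∣ k)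

Proper : ∀ {n k} → Graph n → (Fin n → Fin k) → Set
Proper G f = ∀ u v → u ~ v → ¬ (f u ≡ f v)
  where open Graph G

Colourable : ∀ {n} → Graph n → ℕ → Set
Colourable {n} G k = Σ[ f ∈ (Fin n → Fin k) ] Proper G f

proper? : ∀ {n k} (G : Graph n) (f : Fin n → Fin k) → Dec (Proper G f)
proper? G f = all? λ u → all? λ v → (u ~? v) →-dec ¬? (f u ≟ᶠ f v)
  where open Graph G

-- A colouring Fin n → Fin k is coded by an element of Fin (k ^ n), so the
-- search over all colourings is finite.
colourable? : ∀ {n} (G : Graph n) → Decidable (Colourable G)
colourable? {n} G k =
  map′ (λ (i , p) → finToFun i , p)
       (λ (f , p) → funToFin f , λ u v u~v eq →
          p u v u~v (trans (sym (finToFun-funToFin f u)) (trans eq (finToFun-funToFin f v))))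
       (any? λ i → proper? G (finToFun {k} {n} i))

IsLeast : Pred ℕ 0ℓ → ℕ → Set
IsLeast P k = P k × (∀ j → P j → k ≤ j)

least : {P : Pred ℕ 0ℓ} → Decidable P → ∀ n → P n → ∃[ k ] IsLeast P k
least P? zero    p = zero , p , λ _ _ → z≤n
least {P} P? (suc n) p with P? zero
... | yes p₀ = zero , p₀ , λ _ _ → z≤n
... | no ¬p₀ with least (P? ∘ suc) n p
...   | k , pk , k-min = suc k , pk , λ
        { zero    p₀ → contradiction p₀ ¬p₀
        ; (suc j) pj → s≤s (k-min j pj) }

colourable-order : ∀ {n} (G : Graph n) → Colourable G n
colourable-order G = id , λ u v u~v u≡v → Graph.~-irr G u≡v u~v

leastColouring : ∀ {n} (G : Graph n) → ∃[ k ] IsLeast (Colourable G) k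
leastColouring {n} G = least (colourable? G) n (colourable-order G)

χ : ∀ {n} → Graph n → ℕ
χ G = proj₁ (leastColouring G)

χ-isLeast : ∀ {n} (G : Graph n) → IsLeast (Colourable G) (χ G)
χ-isLeast G = proj₂ (leastColouring G)

{-# OPTIONS --safe #-}

-- Give each component the levels of a breadth-first search; it suffices to colour each
-- level with half of the colours.  Let q lie one level higher, and grow an induced path
-- q, p₀, …, pₘ = p into the level, discarding the neighbours of each vertex when the path
-- moves on.  Let K be what is left.  There are no closed walks of length five, so the
-- vertices of K whose parent is adjacent to a given vertex form a stable set, and those
-- with a parent adjacent to q, to the parent of q or to some pᵢ with i < m cost m + 2
-- colours.  Let a(x) be the least distance from p within K of a neighbour of the parent
-- of x.  The other vertices x are coloured with the parities of a(x) and of the distance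
-- from p within K.
--
-- To see that this is proper, let x and y be adjacent vertices of the same colour, with
-- parents s and r and a(y) ≤ a(x).  Join s to q by an induced path through higher levels
-- and continue it by the pᵢ to p.  From p one can return to s by a shortest path to a
-- neighbour of s, which gives a hole that must be even, as it is long.  One can also return
-- by a shortest path to a neighbour n of r and then by n, r, s if r and s are adjacent, by
-- n, x, s if n and x are adjacent, and by n, r, y, x, s otherwise (if y is at distance a(y)
-- itself, by y, x, s).  This gives a long odd hole, because a(x) and a(y) have equal parity.
module Submission where

open import Defs
open import Data.Empty using (⊥)
open import Data.Fin using (Fin; zero; suc; toℕ; fromℕ<)
open import Data.Fin.Properties using (any?; toℕ-injective; toℕ<n; toℕ-fromℕ<; injective⇒≤) renaming (_≟_ to _≟ᶠ_)
open import Data.List using (List; []; _∷_; _++_; length; lookup)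
open import Data.List.Membership.Propositional using (_∈_)
open import Data.List.Membership.Propositional.Properties using (∈-lookup)
open import Data.List.Properties using (length-++)
open import Data.List.Relation.Unary.All using (All; []; _∷_; zipWith) renaming (map to All-map; lookup to All-lookup)
open import Data.List.Relation.Unary.All.Properties using () renaming (++⁺ to All-++⁺)
open import Data.List.Relation.Unary.Any using (here; there)
open import Data.Nat using (ℕ; zero; suc; _+_; _*_; _∸_; _^_; _≤_; _<_; z≤n; s≤s; s≤s⁻¹; parity) renaming (_≟_ to _≟ℕ_)
open import Data.Nat.Divisibility using (divides)
open import Data.Nat.Properties
open import Data.Nat.Tactic.RingSolver using (solve-∀)
open import Data.Parity using (Parity; 0ℙ; 1ℙ)
import Data.Parity.Base as ℙ
open import Data.Parity.Properties using (+-homo-+; *-homo-*; suc-homo-⁻¹; ⁻¹-selfInverse; p≢p⁻¹)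
open import Data.Product using (Σ-syntax; ∃; ∃-syntax; _×_; _,_; proj₁; proj₂)
open import Data.Sum using (_⊎_; inj₁; inj₂)
open import Data.Unit using (⊤)
open import Function using (_∘_; mk⇔)
open import Level using (0ℓ)
open import Relation.Binary.PropositionalEquality
open import Relation.Nullary using (¬_; Dec; yes; no; ¬?; _×-dec_; _⊎-dec_; contradiction)
open import Relation.Nullary.Decidable using (map′)
open import Relation.Unary using (Pred; Decidable)

-- Induced paths, holes and closed walks of length five.

module Paths {n} (G : Graph n) where
  open Graph G

  ~⇒≢ : ∀ {u v} → u ~ v → u ≢ v
  ~⇒≢ u~v u≡v = ~-irr u≡v u~v

  Apart : Fin n → Fin n → Set
  Apart u v = u ≢ v × ¬ u ~ v

  InducedPath : Fin n → List (Fin n) → Set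
  InducedPath x []       = ⊤
  InducedPath x (y ∷ ys) = x ~ y × All (Apart x) ys × InducedPath y ys

  -- The list omits the vertex at which the path starts: that one is the other neighbour of `s` on
  -- the cycle.
  Closes : Fin n → List (Fin n) → Set
  Closes s []           = ⊥
  Closes s (x ∷ [])     = s ~ x
  Closes s (x ∷ y ∷ ys) = Apart s x × Closes s (y ∷ ys)

  Closes-∷ : ∀ {s x} ys → Apart s x → Closes s ys → Closes s (x ∷ ys)
  Closes-∷ (_ ∷ _) a c = a , c

  Closes-++ : ∀ {s xs} ys → All (Apart s) xs → Closes s ys → Closes s (xs ++ ys)
  Closes-++ ys []       c = c
  Closes-++ {xs = _ ∷ xs} ys (a ∷ as) c = Closes-∷ (xs ++ ys) a (Closes-++ ys as c)

  Closes-length : ∀ {s} xs → Closes s xs → 1 ≤ length xs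
  Closes-length (_ ∷ _) _ = s≤s z≤n

  Closes-≢ : ∀ {s} xs → Closes s xs → ∀ j → s ≢ lookup xs j
  Closes-≢ (x ∷ [])     s~x     zero    = ~⇒≢ s~x
  Closes-≢ (x ∷ y ∷ ys) (a , _) zero    = proj₁ a
  Closes-≢ (x ∷ y ∷ ys) (_ , c) (suc j) = Closes-≢ (y ∷ ys) c j

  Closes-~⇒last : ∀ {s} xs → Closes s xs → ∀ j → s ~ lookup xs j → suc (toℕ j) ≡ length xs
  Closes-~⇒last (x ∷ [])     s~x     zero    _   = refl
  Closes-~⇒last (x ∷ y ∷ ys) (a , _) zero    s~x = contradiction s~x (proj₂ a)
  Closes-~⇒last (x ∷ y ∷ ys) (_ , c) (suc j) s~z = cong suc (Closes-~⇒last (y ∷ ys) c j s~z)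

  Closes-last⇒~ : ∀ {s} xs → Closes s xs → ∀ j → suc (toℕ j) ≡ length xs → s ~ lookup xs j
  Closes-last⇒~ (x ∷ [])     s~x     zero    _  = s~x
  Closes-last⇒~ (x ∷ y ∷ ys) (_ , c) zero    ()
  Closes-last⇒~ (x ∷ y ∷ ys) (_ , c) (suc j) eq = Closes-last⇒~ (y ∷ ys) c j (suc-injective eq)

  InducedPath-injective : ∀ x xs → InducedPath x xs →
    ∀ i j → lookup (x ∷ xs) i ≡ lookup (x ∷ xs) j → i ≡ j
  InducedPath-injective x xs ind zero zero _ = refl
  InducedPath-injective x (y ∷ ys) (x~y , as , ind) zero (suc zero) eq = contradiction eq (~⇒≢ x~y)
  InducedPath-injective x (y ∷ ys) (x~y , as , ind) zero (suc (suc j)) eq =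
    contradiction eq (proj₁ (All-lookup as (∈-lookup j)))
  InducedPath-injective x (y ∷ ys) (x~y , as , ind) (suc zero) zero eq = contradiction (sym eq) (~⇒≢ x~y)
  InducedPath-injective x (y ∷ ys) (x~y , as , ind) (suc (suc j)) zero eq =
    contradiction (sym eq) (proj₁ (All-lookup as (∈-lookup j)))
  InducedPath-injective x (y ∷ ys) (x~y , as , ind) (suc i) (suc j) eq =
    cong suc (InducedPath-injective y ys ind i j eq)

  Consecutive : ∀ {k} → Fin k → Fin k → Set
  Consecutive i j = toℕ j ≡ suc (toℕ i) ⊎ toℕ i ≡ suc (toℕ j)

  Consecutive-suc : ∀ {k} {i j : Fin k} → Consecutive i j → Consecutive (suc i) (suc j)
  Consecutive-suc (inj₁ eq) = inj₁ (cong suc eq)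
  Consecutive-suc (inj₂ eq) = inj₂ (cong suc eq)

  InducedPath-~⇒consecutive : ∀ x xs → InducedPath x xs →
    ∀ i j → lookup (x ∷ xs) i ~ lookup (x ∷ xs) j → Consecutive i j
  InducedPath-~⇒consecutive x xs ind zero zero x~x = contradiction refl (~⇒≢ x~x)
  InducedPath-~⇒consecutive x (y ∷ ys) ind zero (suc zero) _ = inj₁ refl
  InducedPath-~⇒consecutive x (y ∷ ys) (_ , as , _) zero (suc (suc j)) x~z =
    contradiction x~z (proj₂ (All-lookup as (∈-lookup j)))
  InducedPath-~⇒consecutive x (y ∷ ys) ind (suc zero) zero _ = inj₂ refl
  InducedPath-~⇒consecutive x (y ∷ ys) (_ , as , _) (suc (suc j)) zero z~x =
    contradiction (~-sym z~x) (proj₂ (All-lookup as (∈-lookup j)))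
  InducedPath-~⇒consecutive x (y ∷ ys) (_ , _ , ind) (suc i) (suc j) e =
    Consecutive-suc (InducedPath-~⇒consecutive y ys ind i j e)

  InducedPath-next⇒~ : ∀ x xs → InducedPath x xs →
    ∀ i j → toℕ j ≡ suc (toℕ i) → lookup (x ∷ xs) i ~ lookup (x ∷ xs) j
  InducedPath-next⇒~ x (y ∷ ys) (x~y , _) zero (suc zero) _ = x~y
  InducedPath-next⇒~ x (y ∷ ys) (_ , _ , ind) (suc i) (suc j) eq =
    InducedPath-next⇒~ y ys ind i j (suc-injective eq)

  -- The cyclic order is `s ∷ e ∷ zs`. The neighbours of `s` sit at position 1 and at the end, and
  -- all other adjacencies are those of the induced path.
  closedPath⇒hole : ∀ s e zs → InducedPath e zs → s ~ e → Closes s zs → 2 ≤ length zs →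
    Hole G (2 + length zs)
  closedPath⇒hole s e zs ind s~e closes 2≤zs = s≤s (s≤s 2≤zs) , c , injective _ _ , λ i j → mk⇔ (to i j) (from i j)
    where
    k = 2 + length zs
    c : Fin k → Fin n
    c = lookup (s ∷ e ∷ zs)

    s≢ : ∀ j → s ≢ lookup (e ∷ zs) j
    s≢ zero    = ~⇒≢ s~e
    s≢ (suc j) = Closes-≢ zs closes j

    injective : ∀ i j → c i ≡ c j → i ≡ j
    injective zero    zero    _  = refl
    injective zero    (suc j) eq = contradiction eq (s≢ j)
    injective (suc i) zero    eq = contradiction (sym eq) (s≢ i)
    injective (suc i) (suc j) eq = cong suc (InducedPath-injective e zs ind i j eq)

    to₀ : ∀ j → s ~ lookup (e ∷ zs) j → CycleAdjacent k zero (suc j)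
    to₀ zero    _   = inj₁ (inj₁ refl)
    to₀ (suc j) s~z = inj₂ (inj₂ (cong (2 +_) (Closes-~⇒last zs closes j s~z) , refl))

    CycleAdjacent-sym : ∀ {i j} → CycleAdjacent k i j → CycleAdjacent k j i
    CycleAdjacent-sym (inj₁ a) = inj₂ a
    CycleAdjacent-sym (inj₂ a) = inj₁ a

    to : ∀ i j → c i ~ c j → CycleAdjacent k i j
    to zero    zero    s~s = contradiction refl (~⇒≢ s~s)
    to zero    (suc j) s~z = to₀ j s~z
    to (suc i) zero    z~s = CycleAdjacent-sym {zero} {suc i} (to₀ i (~-sym z~s))
    to (suc i) (suc j) z~z with InducedPath-~⇒consecutive e zs ind i j z~z
    ... | inj₁ eq = inj₁ (inj₁ (cong suc eq))
    ... | inj₂ eq = inj₂ (inj₁ (cong suc eq))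

    next : ∀ i j → Next k i j → c i ~ c j
    next zero    zero          (inj₁ ())
    next zero    (suc zero)    (inj₁ _)  = s~e
    next zero    (suc (suc j)) (inj₁ ())
    next (suc i) (suc j)       (inj₁ eq) = InducedPath-next⇒~ e zs ind i j (suc-injective eq)
    next zero          zero (inj₂ (() , _))
    -- The wrap-around edge would leave from `e` only if `zs` were empty.
    next (suc zero)    zero (inj₂ (eq , _)) =
      contradiction (subst (2 ≤_) (sym (suc-injective (suc-injective eq))) 2≤zs) λ ()
    next (suc (suc j)) zero (inj₂ (eq , _)) =
      ~-sym (Closes-last⇒~ zs closes j (suc-injective (suc-injective eq)))
    next zero    (suc j) (inj₂ (_ , ()))
    next (suc i) (suc j) (inj₂ (_ , ()))

    from : ∀ i j → CycleAdjacent k i j → c i ~ c j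
    from i j (inj₁ a) = next i j a
    from i j (inj₂ a) = ~-sym (next j i a)

  module FiveWalks (triangleFree : TriangleFree G) (no5 : ¬ Hole G 5) where

    noTriangle : ∀ {u v w} → u ~ v → v ~ w → u ~ w → ⊥
    noTriangle a b c = triangleFree _ _ _ (a , b , c)

    -- If two vertices of a closed 5-walk coincide, or it has a chord, then there is a triangle.
    no5Walk : ∀ {a b c d e} → a ~ b → b ~ c → c ~ d → d ~ e → e ~ a → ⊥
    no5Walk {a} {b} {c} {d} {e} a~b b~c c~d d~e e~a =
      no5 (closedPath⇒hole a b (c ∷ d ∷ e ∷ []) induced a~b closes (s≤s (s≤s z≤n)))
      where
      induced : InducedPath b (c ∷ d ∷ e ∷ [])
      induced = b~c
        , ((λ { refl → noTriangle d~e e~a (~-sym a~b) }) , noTriangle b~c c~d)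
          ∷ ((λ { refl → noTriangle b~c c~d (~-sym d~e) }) , (λ b~e → noTriangle a~b b~e (~-sym e~a)))
          ∷ []
        , c~d
        , ((λ { refl → noTriangle a~b b~c (~-sym e~a) }) , noTriangle c~d d~e) ∷ []
        , d~e , [] , _
      closes : Closes a (c ∷ d ∷ e ∷ [])
      closes = ((λ { refl → noTriangle c~d d~e (~-sym e~a) }) , noTriangle a~b b~c)
        , ((λ { refl → noTriangle a~b b~c (~-sym c~d) }) , (λ a~d → noTriangle a~d d~e (~-sym e~a)))
        , ~-sym e~a

-- Least witnesses and finite choice.

IsLeast-unique : ∀ {P : Pred ℕ 0ℓ} {j k} → IsLeast P j → IsLeast P k → j ≡ k
IsLeast-unique (pj , j-min) (pk , k-min) = ≤-antisym (j-min _ pk) (k-min _ pj)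

-- The value 0 in the empty case is a dummy, so that functions on all vertices arise even where only
-- some vertices have a witness.
minimum : {P : Pred ℕ 0ℓ} → Decidable P → Dec (∃ P) → ℕ
minimum P? (yes (n , p)) = proj₁ (least P? n p)
minimum P? (no _)        = 0

minimum-isLeast : {P : Pred ℕ 0ℓ} (P? : Decidable P) (∃P? : Dec (∃ P)) → ∃ P → IsLeast P (minimum P? ∃P?)
minimum-isLeast P? (yes (n , p)) _  = proj₂ (least P? n p)
minimum-isLeast P? (no ¬∃)       ∃P = contradiction ∃P ¬∃

IsFirst : ∀ {n} → Pred (Fin n) 0ℓ → Fin n → Set
IsFirst P i = P i × (∀ j → P j → toℕ i ≤ toℕ j)

-- Two equivalent predicates are allowed because adjacent vertices choose representatives by
-- different but equivalent conditions.
IsFirst-unique : ∀ {n} {P Q : Pred (Fin n) 0ℓ} {i j} → (∀ {k} → P k → Q k) → (∀ {k} → Q k → P k) →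
  IsFirst P i → IsFirst Q j → i ≡ j
IsFirst-unique P⇒Q Q⇒P (pi , i-min) (qj , j-min) =
  toℕ-injective (≤-antisym (i-min _ (Q⇒P qj)) (j-min _ (P⇒Q pi)))

first : ∀ {n} {P : Pred (Fin n) 0ℓ} → Decidable P → ∃ P → ∃ (IsFirst P)
first {suc n} P? (i , p) with P? zero
... | yes p₀ = zero , p₀ , λ _ _ → z≤n
first {suc n} P? (zero  , p) | no ¬p₀ = contradiction p ¬p₀
first {suc n} {P} P? (suc i , p) | no ¬p₀ with first (P? ∘ suc) (i , p)
... | j , pj , j-min = suc j , pj , λ
        { zero    p₀ → contradiction p₀ ¬p₀
        ; (suc k) pk → s≤s (j-min k pk) }

pick : ∀ {n} {P : Pred (Fin n) 0ℓ} → Fin n → Dec (∃ P) → Fin n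
pick default (yes (i , _)) = i
pick default (no _)        = default

pick-spec : ∀ {n} {P : Pred (Fin n) 0ℓ} default (∃P? : Dec (∃ P)) → ∃ P → P (pick default ∃P?)
pick-spec default (yes (_ , p)) _  = p
pick-spec default (no ¬∃)       ∃P = contradiction ∃P ¬∃

-- Combining colourings of vertex sets.

module Colourings {n} (G : Graph n) where
  open Graph G

  -- Colours are numbers below `c` rather than elements of `Fin c`, so that palettes can be shifted
  -- by addition; values outside `X` are irrelevant.
  ColourableOn : Pred (Fin n) 0ℓ → ℕ → Set
  ColourableOn X c = Σ[ f ∈ (Fin n → ℕ) ]
    (∀ x → X x → f x < c) × (∀ x y → X x → X y → x ~ y → f x ≢ f y)

  stable⇒colourable : ∀ {X} → (∀ x y → X x → X y → ¬ x ~ y) → ColourableOn X 1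
  stable⇒colourable stable = (λ _ → 0) , (λ _ _ → s≤s z≤n) , λ x y Xx Xy x~y _ → stable x y Xx Xy x~y

  colourable-⊆ : ∀ {X Y : Pred (Fin n) 0ℓ} {c} → (∀ {x} → X x → Y x) → ColourableOn Y c → ColourableOn X c
  colourable-⊆ X⊆Y (f , f< , f-proper) =
    f , (λ x → f< x ∘ X⊆Y) , λ x y Xx Xy → f-proper x y (X⊆Y Xx) (X⊆Y Xy)

  colourable-split : ∀ {X D : Pred (Fin n) 0ℓ} {c d} → Decidable D →
    ColourableOn (λ x → X x × D x) c → ColourableOn (λ x → X x × ¬ D x) d → ColourableOn X (c + d)
  colourable-split {X} {D} {c} {d} D? (f , f< , f-proper) (g , g< , g-proper) = h , h< , h-proper
    where
    h : Fin n → ℕ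
    h x with D? x
    ... | yes _ = f x
    ... | no  _ = c + g x
    h< : ∀ x → X x → h x < c + d
    h< x Xx with D? x
    ... | yes Dx = <-≤-trans (f< x (Xx , Dx)) (m≤m+n c d)
    ... | no ¬Dx = +-monoʳ-< c (g< x (Xx , ¬Dx))
    h-proper : ∀ x y → X x → X y → x ~ y → h x ≢ h y
    h-proper x y Xx Xy x~y with D? x | D? y
    ... | yes Dx | yes Dy = f-proper x y (Xx , Dx) (Xy , Dy) x~y
    ... | no ¬Dx | no ¬Dy = g-proper x y (Xx , ¬Dx) (Xy , ¬Dy) x~y ∘ +-cancelˡ-≡ c _ _
    ... | yes Dx | no  _  = <⇒≢ (<-≤-trans (f< x (Xx , Dx)) (m≤m+n c (g y)))
    ... | no  _  | yes Dy = <⇒≢ (<-≤-trans (f< y (Xy , Dy)) (m≤m+n c (g x))) ∘ sym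

  colourable-≤ : ∀ {X c d} → c ≤ d → ColourableOn X c → ColourableOn X d
  colourable-≤ c≤d (f , f< , f-proper) = f , (λ x Xx → <-≤-trans (f< x Xx) c≤d) , f-proper

  -- Allows a family of colourings to be indexed by all vertices when it is available only for the
  -- valid ones.
  colourable-when : ∀ {A : Set} {X c} → Dec A → (A → ColourableOn X c) → ColourableOn (λ x → A × X x) c
  colourable-when (yes a) colour = colourable-⊆ proj₂ (colour a)
  colourable-when (no ¬a) _      = (λ _ → 0) , (λ _ (a , _) → contradiction a ¬a) , λ _ _ (a , _) → contradiction a ¬a

  -- Taking the first related w makes adjacent vertices use the same colouring.
  colourable-glue : ∀ {X : Pred (Fin n) 0ℓ} {E : Fin n → Pred (Fin n) 0ℓ} {c} →
    (∀ w → Decidable (E w)) → Decidable X → (∀ x → X x → ∃[ w ] E w x) →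
    (∀ {w x y} → X x → X y → x ~ y → E w x → E w y) →
    (∀ w → ColourableOn (λ x → E w x × X x) c) →
    ColourableOn X c
  colourable-glue {X} {E} {c} E? X? cover E-~ colour = f , f< , f-proper
    where
    f : Fin n → ℕ
    f x with X? x
    ... | no _   = 0
    ... | yes Xx = proj₁ (colour (proj₁ (first (λ w → E? w x) (cover x Xx)))) x

    f< : ∀ x → X x → f x < c
    f< x Xx with X? x
    ... | no ¬Xx = contradiction Xx ¬Xx
    ... | yes Xx with first (λ w → E? w x) (cover x Xx)
    ...   | w , Ewx , _ = proj₁ (proj₂ (colour w)) x (Ewx , Xx)

    f-proper : ∀ x y → X x → X y → x ~ y → f x ≢ f y
    f-proper x y Xx Xy x~y with X? x | X? y
    ... | no ¬Xx | _      = contradiction Xx ¬Xx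
    ... | yes _  | no ¬Xy = contradiction Xy ¬Xy
    ... | yes Xx | yes Xy with first (λ w → E? w x) (cover x Xx) | first (λ w → E? w y) (cover y Xy)
    ...   | w , Ewx , w-min | v , Evy , v-min
      with refl ← IsFirst-unique (E-~ Xx Xy x~y) (E-~ Xy Xx (~-sym x~y)) (Ewx , w-min) (Evy , v-min) =
      proj₂ (proj₂ (colour w)) x y (Ewx , Xx) (Evy , Xy) x~y

  parity≢ : ∀ m → parity (suc m) ≢ parity m
  parity≢ m eq = p≢p⁻¹ (parity (suc m)) (trans eq (sym (suc-homo-⁻¹ m)))

  -- Two palettes alternate with the parity of the level. Adjacent vertices differ by at most one in
  -- level, so with equal parity they lie in the same level.
  colourable-levels : ∀ {X : Pred (Fin n) 0ℓ} {c} (lev : Fin n → ℕ) →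
    (∀ x y → X x → X y → x ~ y → lev y ≤ suc (lev x)) →
    (∀ k → ColourableOn (λ x → X x × lev x ≡ k) c) →
    ColourableOn X (c + c)
  colourable-levels {X} {c} lev step colour = f , f< , f-proper
    where
    g : Fin n → ℕ
    g x = proj₁ (colour (lev x)) x
    g< : ∀ x → X x → g x < c
    g< x Xx = proj₁ (proj₂ (colour (lev x))) x (Xx , refl)

    shift : Parity → ℕ → ℕ
    shift 0ℙ i = i
    shift 1ℙ i = c + i
    shift< : ∀ p {i} → i < c → shift p i < c + c
    shift< 0ℙ i<c = <-≤-trans i<c (m≤m+n c c)
    shift< 1ℙ i<c = +-monoʳ-< c i<c
    shift-injective : ∀ p {i j} → shift p i ≡ shift p j → i ≡ j
    shift-injective 0ℙ eq = eq
    shift-injective 1ℙ eq = +-cancelˡ-≡ c _ _ eq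
    shift-parity : ∀ p q {i j} → i < c → j < c → shift p i ≡ shift q j → p ≡ q
    shift-parity 0ℙ 0ℙ _ _ _ = refl
    shift-parity 1ℙ 1ℙ _ _ _ = refl
    shift-parity 0ℙ 1ℙ {j = j} i<c _ eq = contradiction eq (<⇒≢ (<-≤-trans i<c (m≤m+n c j)))
    shift-parity 1ℙ 0ℙ {i} _ j<c eq = contradiction (sym eq) (<⇒≢ (<-≤-trans j<c (m≤m+n c i)))

    f : Fin n → ℕ
    f x = shift (parity (lev x)) (g x)
    f< : ∀ x → X x → f x < c + c
    f< x Xx = shift< (parity (lev x)) (g< x Xx)

    lev≡ : ∀ {i j} → i ≤ suc j → j ≤ suc i → parity i ≡ parity j → i ≡ j
    lev≡ {i} {j} i≤ j≤ eq with m≤n⇒m<n∨m≡n i≤ | m≤n⇒m<n∨m≡n j≤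
    ... | inj₂ refl | _         = contradiction eq (parity≢ j)
    ... | inj₁ _    | inj₂ refl = contradiction (sym eq) (parity≢ i)
    ... | inj₁ i<   | inj₁ j<   = ≤-antisym (s≤s⁻¹ i<) (s≤s⁻¹ j<)

    f-proper : ∀ x y → X x → X y → x ~ y → f x ≢ f y
    f-proper x y Xx Xy x~y eq = proj₂ (proj₂ (colour (lev x))) x y (Xx , refl) (Xy , sym same) x~y
      (subst (λ k → g x ≡ proj₁ (colour k) y) (sym same)
        (shift-injective (parity (lev x)) (trans eq (cong (λ p → shift p (g y)) (sym same-parity)))))
      where
      same-parity = shift-parity (parity (lev x)) (parity (lev y)) (g< x Xx) (g< y Xy) eq
      same = lev≡ (step y x Xy Xx (~-sym x~y)) (step x y Xx Xy x~y) same-parity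

  colourable-parity : ∀ {X : Pred (Fin n) 0ℓ} (f : Fin n → ℕ) →
    (∀ x y → X x → X y → x ~ y → parity (f x) ≢ parity (f y)) → ColourableOn X 2
  colourable-parity f proper = (λ x → value (parity (f x))) , (λ x _ → value< (parity (f x))) ,
    λ x y Xx Xy x~y → proper x y Xx Xy x~y ∘ value-injective (parity (f x)) (parity (f y))
    where
    value : Parity → ℕ
    value 0ℙ = 0
    value 1ℙ = 1
    value< : ∀ p → value p < 2
    value< 0ℙ = s≤s z≤n
    value< 1ℙ = s≤s (s≤s z≤n)
    value-injective : ∀ p q → value p ≡ value q → p ≡ q
    value-injective 0ℙ 0ℙ _ = refl
    value-injective 1ℙ 1ℙ _ = refl

  colourableOn⇒colourable : ∀ {X c} → (∀ x → X x) → ColourableOn X c → Colourable G c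
  colourableOn⇒colourable {c = c} all (f , f< , f-proper) = (λ x → fromℕ< (f< x (all x))) ,
    λ x y x~y eq → f-proper x y (all x) (all y) x~y
      (trans (sym (toℕ-fromℕ< _)) (trans (cong toℕ eq) (toℕ-fromℕ< _)))

-- Walks, distances and shortest paths within a vertex set.

module Walks {n} (G : Graph n) where
  open Graph G
  open Paths G

  -- The starting point w need not lie in K.
  Walk : Pred (Fin n) 0ℓ → Fin n → ℕ → Fin n → Set
  Walk K w zero    x = w ≡ x
  Walk K w (suc t) x = K x × ∃[ y ] Walk K w t y × y ~ x

  Reach : Pred (Fin n) 0ℓ → Fin n → Fin n → Set
  Reach K w x = ∃[ t ] Walk K w t x

  Distance : Pred (Fin n) 0ℓ → Fin n → ℕ → Fin n → Set
  Distance K w t x = IsLeast (λ i → Walk K w i x) t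

  -- With `w = p` and `r = par x`, this is the number a(x) of the overview.
  Touch : Pred (Fin n) 0ℓ → Fin n → Fin n → ℕ → Set
  Touch K w r = IsLeast (λ t → ∃[ u ] Walk K w t u × r ~ u)

  -- The list starts after x, runs along a shortest path to w, and goes on with B.
  data Geodesic (K : Pred (Fin n) 0ℓ) (w : Fin n) (B : List (Fin n)) : ℕ → Fin n → List (Fin n) → Set where
    here : Geodesic K w B 0 w B
    step : ∀ {t x y zs} → Distance K w (suc t) x → Distance K w t y → x ~ y →
      Geodesic K w B t y zs → Geodesic K w B (suc t) x (y ∷ zs)

  walk? : ∀ {K} → Decidable K → ∀ w t → Decidable (Walk K w t)
  walk? K? w zero    x = w ≟ᶠ x
  walk? K? w (suc t) x = K? x ×-dec any? (λ y → walk? K? w t y ×-dec (y ~? x))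

  module _ {K : Pred (Fin n) 0ℓ} where

    Reach-refl : ∀ {w} → Reach K w w
    Reach-refl = 0 , refl

    Reach-step : ∀ {w x y} → Reach K w x → x ~ y → K y → Reach K w y
    Reach-step (t , walk) x~y Ky = suc t , Ky , _ , walk , x~y

    Reach-trans : ∀ {w x y} → Reach K w x → Reach K x y → Reach K w y
    Reach-trans r (zero  , refl) = r
    Reach-trans r (suc t , Kz , y , walk , y~z) = Reach-step (Reach-trans r (t , walk)) y~z Kz

    Walk-∈ : ∀ t {w x} → Walk K w t x → w ≡ x ⊎ K x
    Walk-∈ zero    refl     = inj₁ refl
    Walk-∈ (suc t) (Kx , _) = inj₂ Kx

    Distance-pred : ∀ {w t x} → Distance K w (suc t) x → ∃[ y ] Distance K w t y × y ~ x
    Distance-pred ((Kx , y , walk , y~x) , x-min) =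
      y , (walk , λ i walkᵢ → s≤s⁻¹ (x-min (suc i) (Kx , y , walkᵢ , y~x))) , y~x

    Distance-~ : ∀ {w i j x y} → Distance K w i x → Distance K w j y → x ~ y → K y → j ≤ suc i
    Distance-~ (walk , _) (_ , y-min) x~y Ky = y-min _ (Ky , _ , walk , x~y)

    Distance-unique : ∀ {w i j x} → Distance K w i x → Distance K w j x → i ≡ j
    Distance-unique = IsLeast-unique

    Distance-∈ : ∀ {w t x} → Distance K w (suc t) x → K x
    Distance-∈ ((Kx , _) , _) = Kx

    Distance-below : ∀ {w t x} → Distance K w t x → ∀ i → i ≤ t → ∃[ y ] Distance K w i y
    Distance-below {t = zero}  d zero z≤n = _ , d
    Distance-below {t = suc t} d i i≤ with m≤n⇒m<n∨m≡n i≤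
    ... | inj₂ refl = _ , d
    ... | inj₁ i<   = Distance-below (proj₁ (proj₂ (Distance-pred d))) i (s≤s⁻¹ i<)

    -- Choosing one vertex at each distance up to t gives t + 1 distinct vertices.
    Distance-< : ∀ {w t x} → Distance K w t x → t < n
    Distance-< {w} {t} d = injective⇒≤ {f = λ i → proj₁ (at i)} λ {i} {j} eq → toℕ-injective
      (Distance-unique (proj₂ (at i)) (subst (Distance K w (toℕ j)) (sym eq) (proj₂ (at j))))
      where
      at : (i : Fin (suc t)) → ∃[ y ] Distance K w (toℕ i) y
      at i = Distance-below d (toℕ i) (s≤s⁻¹ (toℕ<n i))

    module _ (K? : Decidable K) where

      distance : ∀ {w x} → Reach K w x → ∃[ t ] Distance K w t x
      distance {w} {x} (t , walk) = least (λ i → walk? K? w i x) t walk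

      -- Only lengths below `n` need to be searched, by `Distance-<`.
      reach? : ∀ w → Decidable (Reach K w)
      reach? w x = map′ (λ (i , walk) → toℕ i , walk) bounded (any? λ i → walk? K? w (toℕ i) x)
        where
        bounded : Reach K w x → ∃[ i ] Walk K w (toℕ {n} i) x
        bounded r with distance r
        ... | t , d@(walk , _) = fromℕ< (Distance-< d) , subst (λ i → Walk K w i x) (sym (toℕ-fromℕ< _)) walk

    -- A shorter walk to `u` would contradict the minimality of `t`.
    Touch-Distance : ∀ {w r t} → Touch K w r t → ∃[ u ] Distance K w t u × r ~ u
    Touch-Distance ((u , walk , r~u) , r-min) = u , (walk , λ i walkᵢ → r-min i (u , walkᵢ , r~u)) , r~u

    Touch-below : ∀ {w r t i u} → Touch K w r t → i < t → Distance K w i u → ¬ r ~ u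
    Touch-below (_ , r-min) i<t (walk , _) r~u = <⇒≱ i<t (r-min _ (_ , walk , r~u))

  module _ {K : Pred (Fin n) 0ℓ} {w : Fin n} {B : List (Fin n)} where

    geodesic : ∀ {t x} → Distance K w t x → ∃[ zs ] Geodesic K w B t x zs
    geodesic {zero}  (refl , _) = B , here
    geodesic {suc t} d with Distance-pred d
    ... | y , dy , y~x with geodesic dy
    ...   | zs , g = y ∷ zs , step d dy (~-sym y~x) g

    Geodesic-length : ∀ {t x zs} → Geodesic K w B t x zs → length zs ≡ t + length B
    Geodesic-length here           = refl
    Geodesic-length (step _ _ _ g) = cong suc (Geodesic-length g)

    Geodesic-All : ∀ {t x zs} {P : Pred (Fin n) 0ℓ} → (∀ {i u} → i < t → Distance K w i u → P u) →
      All P B → Geodesic K w B t x zs → All P zs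
    Geodesic-All below base here            = base
    Geodesic-All below base (step _ dy _ g) = below ≤-refl dy ∷ Geodesic-All (below ∘ m<n⇒m<1+n) base g

    Geodesic-Closes : ∀ {t x zs s} → (∀ {i u} → i < t → Distance K w i u → Apart s u) →
      Closes s B → Geodesic K w B t x zs → Closes s zs
    Geodesic-Closes below base here = base
    Geodesic-Closes below base (step {zs = zs} _ dy _ g) =
      Closes-∷ zs (below ≤-refl dy) (Geodesic-Closes (below ∘ m<n⇒m<1+n) base g)

    -- Unlike `Geodesic-Closes`, this includes `x`. The assumption begins at distance 1, so that `w`
    -- itself may be the neighbour of `s`.
    Geodesic-Closes-∷ : ∀ {t x zs s} → (∀ {i u} → i < t → Distance K w (suc i) u → Apart s u) →
      Closes s (w ∷ B) → Geodesic K w B t x zs → Closes s (x ∷ zs)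
    Geodesic-Closes-∷ upTo base here = base
    Geodesic-Closes-∷ upTo base (step {y = y} {zs} dx _ _ g) =
      Closes-∷ (y ∷ zs) (upTo ≤-refl dx) (Geodesic-Closes-∷ (upTo ∘ m<n⇒m<1+n) base g)

    -- A chord would join vertices whose distances from `w` differ by two or more. Only vertices of
    -- `K` have to be apart from `B`, as `w` may be adjacent to its head.
    Geodesic-InducedPath : ∀ {t x zs} → InducedPath w B → (∀ {u} → K u → All (Apart u) B) →
      Geodesic K w B t x zs → InducedPath x zs
    Geodesic-InducedPath base apart here = base
    Geodesic-InducedPath {t = suc t} {x = x} base apart (step dx dy x~y g) =
      x~y , Geodesic-All far (apart (Distance-∈ dx)) g , Geodesic-InducedPath base apart g
      where
      far : ∀ {i u} → i < t → Distance K w i u → Apart x u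
      far i<t du =
        (λ { refl → <⇒≢ (m<n⇒m<1+n i<t) (Distance-unique du dx) }) ,
        λ x~u → <⇒≱ i<t (s≤s⁻¹ (Distance-~ du dx (~-sym x~u) (Distance-∈ dx)))

-- Levellings, and detours through smaller levels.

record Levelling {n} (G : Graph n) : Set where
  open Graph G
  field
    lev    : Fin n → ℕ
    par    : Fin n → Fin n
    root   : Fin n → Fin n
    lev-~  : ∀ {x y} → x ~ y → lev y ≤ suc (lev x)
    par-~  : ∀ {x k} → lev x ≡ suc k → x ~ par x
    par-lev : ∀ {x k} → lev x ≡ suc k → lev (par x) ≡ k
    root-~ : ∀ {x y} → x ~ y → root x ≡ root y
    lev≡0⇒root : ∀ {x} → lev x ≡ 0 → root x ≡ x

module Levels {n} (G : Graph n) (L : Levelling G)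
  (triangleFree : TriangleFree G) (no5 : ¬ Hole G 5) where
  open Graph G
  open Paths G
  open FiveWalks triangleFree no5
  open Walks G
  open Colourings G
  open Levelling L

  lev≢⇒≢ : ∀ {u v} → lev u ≢ lev v → u ≢ v
  lev≢⇒≢ lev≢ refl = lev≢ refl

  Apart-lev : ∀ {u v} → 2 + lev u ≤ lev v → Apart v u
  Apart-lev far = (λ { refl → <⇒≢ (<-trans (n<1+n _) far) refl }) , λ v~u → <⇒≱ far (lev-~ (~-sym v~u))

  -- A vertex of level e + 1 can be adjacent to the path only in par q or par s (path omits q).
  record Detour (q s : Fin n) (e : ℕ) : Set where
    field
      path      : List (Fin n)
      induced   : InducedPath q path
      closes    : Closes s path
      locations : All (λ u → lev u < e ⊎ u ≡ par q ⊎ u ≡ par s) path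

  module _ {e : ℕ} {T : Fin n} where
    -- `T` will be `par q`, at level `e`. A walk from `par s` in this set meets level `e` only in
    -- `par s`, where it starts, and in `T`.
    Low : Pred (Fin n) 0ℓ
    Low u = lev u < e ⊎ u ≡ T

    low? : Decidable Low
    low? u = (lev u <? e) ⊎-dec (u ≟ᶠ T)

    -- Along the chain of parents, only the end `u` can have level `e`, and then it has to be `T`.
    down : ∀ k {u} → lev u ≡ k → k < e ⊎ (u ≡ T × k ≡ e) → Reach Low (root u) u
    down zero    {u} lev≡ _ rewrite lev≡0⇒root lev≡ = Reach-refl
    down (suc k) {u} lev≡ low =
      subst (λ z → Reach Low z u) (root-~ (~-sym u~par))
        (Reach-step (down k (par-lev lev≡) (inj₁ (k<e low))) (~-sym u~par) (u∈Low low))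
      where
      u~par = par-~ lev≡
      k<e : suc k < e ⊎ (u ≡ T × suc k ≡ e) → k < e
      k<e (inj₁ k+1<e)       = <-trans (n<1+n _) k+1<e
      k<e (inj₂ (_ , refl)) = ≤-refl
      u∈Low : suc k < e ⊎ (u ≡ T × suc k ≡ e) → Low u
      u∈Low (inj₁ k+1<e)     = inj₁ (subst (_< e) (sym lev≡) k+1<e)
      u∈Low (inj₂ (u≡T , _)) = inj₂ u≡T

    -- The start of a walk is exempt from `Low`, so here `u` may be any vertex of level `e`.
    up : ∀ k {u} → lev u ≡ k → k ≤ e → Reach Low u (root u)
    up zero    lev≡ _ rewrite lev≡0⇒root lev≡ = Reach-refl
    up (suc k) {u} lev≡ k<e =
      subst (Reach Low u) (root-~ (~-sym u~par))
        (Reach-trans (Reach-step Reach-refl u~par (inj₁ (subst (_< e) (sym (par-lev lev≡)) k<e)))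
          (up k (par-lev lev≡) (<⇒≤ k<e)))
      where u~par = par-~ lev≡

  -- The path is a shortest one to `par s` from a neighbour of `q`. Choosing that neighbour nearest
  -- to `par s` spares `q` any chord; `s` sees only `par s`, by its level and because it is not
  -- adjacent to `par q`.
  detour : ∀ {q s e} → lev q ≡ suc e → lev s ≡ suc e → root q ≡ root s → ¬ s ~ par q → Detour q s e
  detour {q} {s} {e} lev-q lev-s root≡ s≁T with least touch? (proj₁ T-reached) (T , proj₂ T-reached , q~T)
    where
    T = par q
    t = par s
    q~T = par-~ lev-q
    touch? : Decidable (λ i → ∃[ u ] Walk (Low {e} {T}) t i u × q ~ u)
    touch? i = any? λ u → walk? low? t i u ×-dec (q ~? u)
    root-tT : root t ≡ root T
    root-tT = trans (sym (root-~ (par-~ lev-s))) (trans (sym root≡) (root-~ q~T))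
    T-reached : Reach (Low {e} {T}) t T
    T-reached = Reach-trans (subst (Reach Low t) root-tT (up e (par-lev lev-s) ≤-refl))
      (down e (par-lev lev-q) (inj₂ (refl , refl)))
  ... | a , touch with Touch-Distance touch
  ...   | u , du , q~u with geodesic {B = []} du
  ...     | zs , g = record
    { path      = u ∷ zs
    ; induced   = q~u , Geodesic-All q-apart [] g , Geodesic-InducedPath _ (λ _ → []) g
    ; closes    = Geodesic-Closes-∷ (λ _ d → s-apart (Distance-∈ d)) (par-~ lev-s) g
    ; locations = location du ∷ Geodesic-All (λ _ → location) [] g
    }
    where
    T = par q
    t = par s
    location : ∀ {i v} → Distance (Low {e} {T}) t i v → lev v < e ⊎ v ≡ T ⊎ v ≡ t
    location {zero}  (t≡v , _) = inj₂ (inj₂ (sym t≡v))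
    location {suc i} d with Distance-∈ d
    ... | inj₁ lev<  = inj₁ lev<
    ... | inj₂ v≡T   = inj₂ (inj₁ v≡T)
    s-apart : ∀ {v} → Low {e} {T} v → Apart s v
    s-apart (inj₁ lev<) = Apart-lev (subst (2 + lev _ ≤_) (sym lev-s) (s≤s lev<))
    s-apart (inj₂ refl) = lev≢⇒≢ (λ eq → 1+n≢n (trans (sym lev-s) (trans eq (par-lev lev-q)))) , s≁T
    lev≤e : ∀ {v} → lev v < e ⊎ v ≡ T ⊎ v ≡ t → lev v ≤ e
    lev≤e (inj₁ lev<)        = <⇒≤ lev<
    lev≤e (inj₂ (inj₁ refl)) = ≤-reflexive (par-lev lev-q)
    lev≤e (inj₂ (inj₂ refl)) = ≤-reflexive (par-lev lev-s)
    q-apart : ∀ {i v} → i < a → Distance (Low {e} {T}) t i v → Apart q v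
    q-apart i<a d = lev≢⇒≢ (λ eq → <⇒≢ (s≤s (lev≤e (location d))) (trans (sym eq) lev-q)) , Touch-below touch i<a d

  -- p ∷ B is an induced path ending in q; the field induced says so in a form that allows
  -- the path to be continued beyond q.
  record Trail (q p : Fin n) (B : List (Fin n)) (K : Pred (Fin n) 0ℓ) : Set where
    field
      q∈B     : q ∈ B
      B-lev   : All (λ u → lev u ≡ suc (lev q) ⊎ u ≡ q) B
      p-lev   : lev p ≡ suc (lev q)
      p∉K     : ¬ K p
      K-lev   : ∀ {x} → K x → lev x ≡ suc (lev q)
      K-root  : ∀ {x} → K x → root q ≡ root x
      K-apart : ∀ {x} → K x → All (Apart x) B
      induced : ∀ {ys} → InducedPath q ys → All (λ u → lev u < lev q) ys → InducedPath p (B ++ ys)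

  -- For such `x`, the parent has no neighbour on the trail before its end `p`, so a hole can be
  -- closed there.
  record Clean (q : Fin n) (B : List (Fin n)) (K : Pred (Fin n) 0ℓ) (x : Fin n) : Set where
    field
      x∈K   : K x
      par≁T : ¬ par x ~ par q
      par≁B : All (λ u → ¬ par x ~ u) B

  -- Colouring what is left when the trail is complete.

  module TrailEnd (m : ℕ) (noHole : ∀ k → parity k ≡ 1ℙ → m + 4 ≤ k → ¬ Hole G k)
    {q p : Fin n} {B : List (Fin n)} {K : Pred (Fin n) 0ℓ} (trail : Trail q p B K) (length-B : length B ≡ suc m) where
    open Trail trail

    Distance-lev : ∀ {i u} → Distance K p i u → lev u ≡ suc (lev q)
    Distance-lev {zero}  (refl , _) = p-lev
    Distance-lev {suc i} d = K-lev (Distance-∈ d)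

    module _ {x : Fin n} (clean : Clean q B K x) where
      open Clean clean

      x~par : x ~ par x
      x~par = par-~ (K-lev x∈K)

      lev-par : lev (par x) ≡ lev q
      lev-par = par-lev (K-lev x∈K)

      par≢q : par x ≢ q
      par≢q par≡q = proj₂ (All-lookup (K-apart x∈K) q∈B) (subst (x ~_) par≡q x~par)

      Apart-par : ∀ {u} → lev u ≡ suc (lev q) → ¬ par x ~ u → Apart (par x) u
      Apart-par lev-u par≁u = lev≢⇒≢ (λ eq → 1+n≢n (trans (sym lev-u) (trans (sym eq) lev-par))) , par≁u

      Apart-B : All (Apart (par x)) B
      Apart-B = zipWith (λ { (inj₁ lev-u , ≁) → Apart-par lev-u ≁ ; (inj₂ refl , ≁) → par≢q , ≁ }) (B-lev , par≁B)

      root-par : root q ≡ root (par x)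
      root-par = trans (K-root x∈K) (root-~ x~par)

      -- A component has only one vertex of level 0, so otherwise `par x` would be `q`.
      lev-q>0 : ∃[ e ] lev q ≡ suc e
      lev-q>0 with lev q in eq
      ... | suc e = e , refl
      ... | zero  = contradiction
        (trans (sym (lev≡0⇒root (trans lev-par eq))) (trans (sym root-par) (lev≡0⇒root eq))) par≢q

    module Conflict {x y : Fin n} (cx : Clean q B K x) (cy : Clean q B K y) (x~y : x ~ y)
      {e : ℕ} (lev-q : lev q ≡ suc e) (detour-s : Detour q (par x) e) where
      private
        module X = Clean cx
        module Y = Clean cy
      s = par x
      r = par y
      open Detour detour-s renaming (induced to path-induced)

      base : List (Fin n)
      base = B ++ path

      path-lev : All (λ u → lev u < lev q) path
      path-lev = All-map low locations
        where
        low : ∀ {u} → lev u < e ⊎ u ≡ par q ⊎ u ≡ par s → lev u < lev q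
        low (inj₁ lev<)        = <-trans lev< (subst (e <_) (sym lev-q) ≤-refl)
        low (inj₂ (inj₁ refl)) = subst₂ _<_ (sym (par-lev lev-q)) (sym lev-q) ≤-refl
        low (inj₂ (inj₂ refl)) = subst₂ _<_ (sym (par-lev (trans (lev-par cx) lev-q))) (sym lev-q) ≤-refl

      base-induced : InducedPath p base
      base-induced = induced path-induced path-lev

      base-apart : ∀ {u} → K u → All (Apart u) base
      base-apart u∈K = All-++⁺ (K-apart u∈K)
        (All-map (λ lev< → Apart-lev (subst (2 + lev _ ≤_) (sym (K-lev u∈K)) (s≤s lev<))) path-lev)

      base-closes : Closes s base
      base-closes = Closes-++ path (Apart-B cx) closes

      -- `B` has `m + 1` vertices and the detour at least one. Adding `s` and the start of the path
      -- gives the `m + 4` of `noHole`.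
      base-length : m + 2 ≤ length base
      base-length rewrite length-++ B {path} | length-B | +-suc m 1 =
        s≤s (+-monoʳ-≤ m (Closes-length path closes))

      base-apart-r : All (Apart r) base
      base-apart-r = All-++⁺ (Apart-B cy) (All-map far locations)
        where
        far : ∀ {u} → lev u < e ⊎ u ≡ par q ⊎ u ≡ par s → Apart r u
        far (inj₁ lev<) = Apart-lev (subst (2 + lev _ ≤_) (sym (trans (lev-par cy) lev-q)) (s≤s lev<))
        far (inj₂ (inj₁ refl)) =
          lev≢⇒≢ (λ eq → 1+n≢n (trans (sym (trans (lev-par cy) lev-q)) (trans eq (par-lev lev-q)))) , Y.par≁T
        far (inj₂ (inj₂ refl)) =
          lev≢⇒≢ (λ eq → 1+n≢n (trans (sym (trans (lev-par cy) lev-q)) (trans eq (par-lev (trans (lev-par cx) lev-q))))) ,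
          -- The closed walk is `r`, `par s`, `s`, `x`, `y`.
          λ r~t → no5Walk r~t (~-sym (par-~ (trans (lev-par cx) lev-q))) (~-sym (x~par cx)) x~y (x~par cy)

      noClosedPath : ∀ {v zs} → InducedPath v zs → s ~ v → Closes s zs →
        parity (length zs) ≡ 1ℙ → m + 2 ≤ length zs → ⊥
      noClosedPath {v} {zs} ind s~v cl odd long = noHole (2 + length zs) odd m+4≤
        (closedPath⇒hole s v zs ind s~v cl (≤-trans (m≤n+m 2 m) long))
        where
        m+4≤ : m + 4 ≤ 2 + length zs
        m+4≤ = subst (_≤ 2 + length zs) (sym (trans (cong (m +_) (+-comm 2 2)) (trans (sym (+-assoc m 2 2)) (+-comm (m + 2) 2))))
          (s≤s (s≤s long))

      Geodesic-long : ∀ {a v zs} → Geodesic K p base a v zs → m + 2 ≤ length zs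
      Geodesic-long {a} g = subst (m + 2 ≤_) (sym (Geodesic-length g)) (≤-trans base-length (m≤n+m _ a))

      module _ {aₛ : ℕ} (touch-s : Touch K p s aₛ) where

        -- No vertex at distance less than `aₛ` is adjacent to `s`, so the only neighbour of `s`
        -- after `v` is the end of the detour.
        closes-geodesic : ∀ {a v zs} → a ≤ aₛ → Geodesic K p base a v zs → Closes s zs
        closes-geodesic a≤aₛ = Geodesic-Closes
          (λ i<a d → Apart-par cx (Distance-lev d) (Touch-below touch-s (<-≤-trans i<a a≤aₛ) d)) base-closes

        geodesic-induced : ∀ {a v zs} → Geodesic K p base a v zs → InducedPath v zs
        geodesic-induced = Geodesic-InducedPath base-induced base-apart

        -- Returning from `p` directly to a nearest neighbour of `s` would otherwise give a long odd
        -- hole.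
        even-length : parity (aₛ + length base) ≢ 1ℙ
        even-length odd with Touch-Distance touch-s
        ... | n , dn , s~n with geodesic {B = base} dn
        ...   | zs , g = noClosedPath (geodesic-induced g) s~n (closes-geodesic ≤-refl g)
          (trans (cong parity (Geodesic-length g)) odd) (Geodesic-long g)

        geodesic-even : ∀ {a v zs} → parity a ≡ parity aₛ → Geodesic K p base a v zs → parity (length zs) ≡ 0ℙ
        geodesic-even {a} same g with parity (aₛ + length base) in eq
        ... | 1ℙ = contradiction eq even-length
        ... | 0ℙ = trans (cong parity (Geodesic-length g))
          (trans (+-homo-+ a (length base)) (trans (cong (ℙ._+ parity (length base)) same)
            (trans (sym (+-homo-+ aₛ (length base))) eq)))

        geodesic-odd : ∀ {a v zs} → parity a ≡ parity aₛ → Geodesic K p base a v zs → parity (suc (length zs)) ≡ 1ℙ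
        geodesic-odd {zs = zs} same g =
          trans (sym (⁻¹-selfInverse (suc-homo-⁻¹ (length zs)))) (cong ℙ._⁻¹ (geodesic-even same g))

        -- Compared with the even hole, passing from `n` to `s` through `v` adds one vertex, while
        -- `a` has the parity of `aₛ`.
        short-detour : ∀ {a n zs v} → a ≤ aₛ → parity a ≡ parity aₛ → Distance K p a n → ¬ s ~ n →
          s ~ v → v ~ n → Geodesic K p base a n zs → All (Apart v) zs → ⊥
        short-detour {n = n} {zs} a≤aₛ same dn s≁n s~v v~n g v-apart = noClosedPath
          (v~n , v-apart , geodesic-induced g) s~v
          (Closes-∷ zs (Apart-par cx (Distance-lev dn) s≁n) (closes-geodesic a≤aₛ g))
          (geodesic-odd same g)
          (m≤n⇒m≤1+n (Geodesic-long g))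

        conflict : ∀ {aᵣ j} → Touch K p r aᵣ → aᵣ ≤ aₛ → parity aᵣ ≡ parity aₛ →
          Distance K p j x → Distance K p j y → ⊥
        conflict {aᵣ} {j} touch-r aᵣ≤aₛ same dx dy with m≤n⇒m<n∨m≡n (proj₂ touch-r j (y , proj₁ dy , ~-sym (x~par cy)))
        -- Here `y` itself is a nearest neighbour of `r` and takes the role of `n`, with `x` between
        -- it and `s`.
        ... | inj₂ refl with geodesic {B = base} dy
        ...   | zs , g = short-detour aᵣ≤aₛ same dy
          (λ s~y → noTriangle x~y (~-sym s~y) (x~par cx)) (~-sym (x~par cx)) x~y g
          (apart-y g dx)
          where
          -- The vertex after `y` is not adjacent to `x`, for want of triangles; the later ones are
          -- too close to `p`, or belong to `base`.
          apart-y : ∀ {i ws} → Geodesic K p base i y ws → Distance K p i x → All (Apart x) ws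
          apart-y here _ = contradiction Y.x∈K p∉K
          apart-y (step _ du y~u h) dx =
            ((λ { refl → 1+n≢n (Distance-unique dx du) }) , λ x~u → noTriangle x~y y~u x~u) ∷
            Geodesic-All (λ i<t dv →
              (λ { refl → <⇒≢ (m<n⇒m<1+n i<t) (Distance-unique dv dx) }) ,
              λ x~v → <⇒≱ i<t (s≤s⁻¹ (Distance-~ dv dx (~-sym x~v) X.x∈K))) (base-apart X.x∈K) h
        -- Now `n` is closer to `p` than `x` and `y`, and the vertices between `n` and `p` are at
        -- distance at most `j - 2`, hence apart from `x` and `y`.
        conflict {aᵣ} {j} touch-r aᵣ≤aₛ same dx dy | inj₁ aᵣ<j with Touch-Distance touch-r
        ... | n , dn , r~n with geodesic {B = base} dn
        ...   | zs , g = by-cases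
          where
          s≁n : ¬ s ~ n
          s≁n s~n = no5Walk s~n (~-sym r~n) (~-sym (x~par cy)) (~-sym x~y) (x~par cx)
          far : ∀ {u i v} → K u → Distance K p j u → i < aᵣ → Distance K p i v → Apart u v
          far u∈K du i<a dv =
            (λ { refl → <⇒≢ (<-trans i<a aᵣ<j) (Distance-unique dv du) }) ,
            λ u~v → <⇒≱ (≤-<-trans i<a aᵣ<j) (Distance-~ dv du (~-sym u~v) u∈K)
          x-apart : All (Apart x) zs
          x-apart = Geodesic-All (far X.x∈K dx) (base-apart X.x∈K) g
          y-apart : All (Apart y) zs
          y-apart = Geodesic-All (far Y.x∈K dy) (base-apart Y.x∈K) g
          r-apart : All (Apart r) zs
          r-apart = Geodesic-All (λ i<a d → Apart-par cy (Distance-lev d) (Touch-below touch-r i<a d)) base-apart-r g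
          x≢n : x ≢ n
          x≢n refl = <⇒≢ aᵣ<j (Distance-unique dn dx)
          y≢n : y ≢ n
          y≢n refl = <⇒≢ aᵣ<j (Distance-unique dn dy)
          y≁n : ¬ y ~ n
          y≁n y~n = noTriangle y~n (~-sym r~n) (x~par cy)
          x≢r : x ≢ r
          x≢r = lev≢⇒≢ (λ eq → 1+n≢n (trans (sym (K-lev X.x∈K)) (trans eq (lev-par cy))))
          s≢r : s ≢ r
          s≢r s≡r = noTriangle x~y (x~par cy) (subst (x ~_) s≡r (x~par cx))
          x≁r : ¬ x ~ r
          x≁r x~r = noTriangle x~y (x~par cy) x~r
          s≁y : ¬ s ~ y
          s≁y s~y = noTriangle x~y (~-sym s~y) (x~par cx)
          s-apart-n : Apart s n
          s-apart-n = Apart-par cx (Distance-lev dn) s≁n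
          by-cases : ⊥
          -- Between `s` and `n` the hole has `x`, or `r`, or all of `x`, `y`, `r`: one vertex or
          -- three, with the same effect on parity.
          by-cases with x ~? n | s ~? r
          ... | yes x~n | _       = short-detour aᵣ≤aₛ same dn s≁n (~-sym (x~par cx)) x~n g x-apart
          ... | no _    | yes s~r = short-detour aᵣ≤aₛ same dn s≁n s~r r~n g r-apart
          ... | no x≁n  | no s≁r  = noClosedPath
            (x~y , (x≢r , x≁r) ∷ (x≢n , x≁n) ∷ x-apart , x~par cy , (y≢n , y≁n) ∷ y-apart , r~n , r-apart , geodesic-induced g)
            (~-sym (x~par cx))
            (Apart-par cx (K-lev Y.x∈K) s≁y , (s≢r , s≁r) , Closes-∷ zs s-apart-n (closes-geodesic aᵣ≤aₛ g))
            (geodesic-odd same g) (m≤n⇒m≤o+n 3 (Geodesic-long g))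

    module _ (K? : Decidable K) where

      Kept : Pred (Fin n) 0ℓ
      Kept x = (Reach K p x × K x × ¬ par x ~ par q) × All (λ u → ¬ par x ~ u) B

      private
        touching : Fin n → ℕ → Set
        touching x t = ∃[ u ] Walk K p t u × par x ~ u
        touching? : ∀ x → Decidable (touching x)
        touching? x t = any? λ u → walk? K? p t u ×-dec (par x ~? u)
        ∃touching? : ∀ x → Dec (∃ (touching x))
        -- Searching for the vertex `u` instead of the length `t` makes this a finite search.
        ∃touching? x = map′ (λ (u , (t , walk) , e) → t , u , walk , e) (λ (t , u , walk , e) → u , (t , walk) , e)
          (any? λ u → reach? K? p u ×-dec (par x ~? u))
        dist : Fin n → ℕ
        dist x = minimum (λ t → walk? K? p t x) (reach? K? p x)
        height : Fin n → ℕ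
        height x = minimum (touching? x) (∃touching? x)

        dist-spec : ∀ {x} → Kept x → Distance K p (dist x) x
        dist-spec {x} ((reach , _) , _) = minimum-isLeast (λ t → walk? K? p t x) (reach? K? p x) reach
        clean : ∀ {x} → Kept x → Clean q B K x
        clean ((_ , x∈K , ≁T) , ≁B) = record { x∈K = x∈K ; par≁T = ≁T ; par≁B = ≁B }
        height-spec : ∀ {x} → Kept x → Touch K p (par x) (height x)
        height-spec {x} kept@(((t , walk) , x∈K , _) , _) =
          minimum-isLeast (touching? x) (∃touching? x) (t , x , walk , ~-sym (x~par (clean kept)))

        ordered : ∀ {x y} → Kept x → Kept y → x ~ y → dist x ≡ dist y →
          parity (height y) ≡ parity (height x) → ¬ height y ≤ height x
        ordered {x} {y} kx ky x~y same same-parity y≤x with lev-q>0 (clean kx)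
        ... | e , lev-q = Conflict.conflict (clean kx) (clean ky) x~y lev-q
          (detour lev-q (trans (lev-par (clean kx)) lev-q) (root-par (clean kx)) (Clean.par≁T (clean kx)))
          (height-spec kx) (height-spec ky) y≤x same-parity (dist-spec kx) (subst (λ i → Distance K p i y) (sym same) (dist-spec ky))

        proper : ∀ {x y} → Kept x → Kept y → x ~ y → dist x ≡ dist y → parity (height x) ≢ parity (height y)
        proper {x} {y} kx ky x~y same same-parity with ≤-total (height y) (height x)
        ... | inj₁ y≤x = ordered kx ky x~y same (sym same-parity) y≤x
        ... | inj₂ x≤y = ordered ky kx (~-sym x~y) (sym same) same-parity x≤y

      -- Two parities of the distance from `p` times two parities of the height.
      kept-colourable : ColourableOn Kept 4
      kept-colourable = colourable-levels dist
        (λ x y kx ky x~y → Distance-~ (dist-spec kx) (dist-spec ky) x~y (Clean.x∈K (clean ky)))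
        λ k → colourable-parity height λ x y (kx , x≡k) (ky , y≡k) x~y → proper kx ky x~y (trans x≡k (sym y≡k))

      -- Each `u` costs one colour: adjacent `x` and `y` whose parents are both adjacent to `u`
      -- would lie on a closed walk of length five.
      removing : ∀ us {X : Pred (Fin n) 0ℓ} {c} → (∀ {x} → X x → lev x ≡ suc (lev q)) →
        ColourableOn (λ x → X x × All (λ u → ¬ par x ~ u) us) c → ColourableOn X (length us + c)
      removing []       X-lev colour = colourable-⊆ (_, []) colour
      removing (u ∷ us) X-lev colour = colourable-split (λ x → par x ~? u)
        (stable⇒colourable λ x y (Xx , x→u) (Xy , y→u) x~y →
          no5Walk (par-~ (X-lev Xx)) x→u (~-sym y→u) (~-sym (par-~ (X-lev Xy))) (~-sym x~y))
        (removing us (X-lev ∘ proj₁) (colourable-⊆ (λ ((Xx , ≁u) , ≁us) → Xx , ≁u ∷ ≁us) colour))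

      end-colourable : ColourableOn (λ x → Reach K p x × K x × ¬ par x ~ par q) (suc m + 4)
      end-colourable = subst (λ i → ColourableOn _ (i + 4)) length-B
        (removing B (λ (_ , x∈K , _) → K-lev x∈K) kept-colourable)

  -- Growing the trail and colouring a level.

  _∖N_ : Pred (Fin n) 0ℓ → Fin n → Pred (Fin n) 0ℓ
  (K ∖N p) x = K x × ¬ p ~ x

  ∖N? : ∀ {K} → Decidable K → ∀ p → Decidable (K ∖N p)
  ∖N? K? p x = K? x ×-dec ¬? (p ~? x)

  -- `v` is the last neighbour of `p` on the walk.
  Walk-∖N : ∀ {K p} → ¬ K p → ∀ t {x} → Walk K p t x → (K ∖N p) x → ∃[ v ] (p ~ v × K v) × Reach (K ∖N p) v x
  Walk-∖N p∉K zero refl (x∈K , _) = contradiction x∈K p∉K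
  Walk-∖N {p = p} p∉K (suc t) (_ , y , walk , y~x) x∈@(_ , p≁x) with Walk-∈ t walk | p ~? y
  ... | inj₁ refl | _       = contradiction y~x p≁x
  ... | inj₂ y∈K  | yes p~y = y , (p~y , y∈K) , Reach-step Reach-refl y~x x∈
  ... | inj₂ y∈K  | no p≁y with Walk-∖N p∉K t walk (y∈K , p≁y)
  ...   | v , valid , reach = v , valid , Reach-step reach y~x x∈

  -- Every remaining vertex is reached from some neighbour `v` of `p` while avoiding the other
  -- neighbours, and adjacent vertices are reached from the same ones. So it suffices to move the
  -- end of the trail to each `v` separately.
  extend : ∀ {K P : Pred (Fin n) 0ℓ} {p c} → Decidable K → Decidable P → ¬ K p →
    (∀ {v} → p ~ v → K v → ColourableOn (λ x → Reach (K ∖N p) v x × (K ∖N p) x × P x) c) →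
    ColourableOn (λ x → (Reach K p x × K x × P x) × ¬ p ~ x) c
  extend {K} {P} {p} K? P? p∉K colour = colourable-glue
    {E = λ v x → (p ~ v × K v) × Reach (K ∖N p) v x}
    (λ v x → (p ~? v ×-dec K? v) ×-dec reach? (∖N? K? p) v x)
    (λ x → (reach? K? p x ×-dec K? x ×-dec P? x) ×-dec ¬? (p ~? x))
    (λ x (((t , walk) , x∈K , _) , p≁x) → Walk-∖N p∉K t walk (x∈K , p≁x))
    (λ _ ((_ , y∈K , _) , p≁y) x~y (valid , reach) → valid , Reach-step reach x~y (y∈K , p≁y))
    λ v → colourable-⊆ (λ ((valid , reach) , ((_ , x∈K , Px) , p≁x)) → valid , reach , (x∈K , p≁x) , Px)
      (colourable-when (p ~? v ×-dec K? v) λ (p~v , v∈K) → colour p~v v∈K)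

  module _ (m : ℕ) (noHole : ∀ k → parity k ≡ 1ℙ → m + 4 ≤ k → ¬ Hole G k) where

    Trail-extend : ∀ {q p v B K} → Trail q p B K → p ~ v → K v → Trail q v (p ∷ B) (K ∖N p)
    Trail-extend trail p~v v∈K = record
      { q∈B     = there q∈B
      ; B-lev   = inj₁ p-lev ∷ B-lev
      ; p-lev   = K-lev v∈K
      ; p∉K     = λ (_ , p≁v) → p≁v p~v
      ; K-lev   = K-lev ∘ proj₁
      ; K-root  = K-root ∘ proj₁
      ; K-apart = λ (x∈K , p≁x) → ((λ { refl → p∉K x∈K }) , p≁x ∘ ~-sym) ∷ K-apart x∈K
      ; induced = λ ind low → ~-sym p~v ,
          All-++⁺ (K-apart v∈K) (All-map (λ lev< → Apart-lev (subst (2 + lev _ ≤_) (sym (K-lev v∈K)) (s≤s lev<))) low) ,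
          induced ind low
      }
      where open Trail trail

    -- Each of the `i` steps still to be made costs one colour, for the neighbours of the current
    -- end.
    trail-colourable : ∀ i {q p B K} → Decidable K → Trail q p B K → length B + i ≡ suc m →
      ColourableOn (λ x → Reach K p x × K x × ¬ par x ~ par q) (i + (suc m + 4))
    trail-colourable zero K? trail len =
      TrailEnd.end-colourable m noHole trail (trans (sym (+-identityʳ _)) len) K?
    trail-colourable (suc i) {q} {p} {B} K? trail len = colourable-split (λ x → p ~? x)
      (stable⇒colourable λ x y (_ , p~x) (_ , p~y) x~y → noTriangle p~x x~y p~y)
      (extend K? (λ x → ¬? (par x ~? par q)) (Trail.p∉K trail) λ p~v v∈K →
        trail-colourable i (∖N? K? p) (Trail-extend trail p~v v∈K) (trans (sym (+-suc (length B) i)) len))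

    Above : Fin n → Pred (Fin n) 0ℓ
    Above q x = lev x ≡ suc (lev q) × root q ≡ root x

    above? : ∀ q → Decidable (Above q)
    above? q x = lev x ≟ℕ suc (lev q) ×-dec root q ≟ᶠ root x

    -- Unless q is a root, these vertices are joined to par q by paths of length two.
    near-stable : ∀ q x y → Above q x → Above q y → q ~ x ⊎ par x ~ par q → q ~ y ⊎ par y ~ par q → ¬ x ~ y
    near-stable q x y (lev-x , root-x) (lev-y , root-y) near-x near-y x~y with lev q in eq
    ... | zero = noTriangle (q~ lev-x root-x) x~y (q~ lev-y root-y)
      where
      q~ : ∀ {z} → lev z ≡ 1 → root q ≡ root z → q ~ z
      q~ {z} lev-z root-z = subst (_~ z)
        (trans (sym (lev≡0⇒root (par-lev lev-z))) (trans (sym (root-~ (par-~ lev-z))) (trans (sym root-z) (lev≡0⇒root eq))))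
        (~-sym (par-~ lev-z))
    ... | suc e with via lev-x near-x | via lev-y near-y
      where
      via : ∀ {z} → lev z ≡ suc (suc e) → q ~ z ⊎ par z ~ par q → ∃[ v ] z ~ v × v ~ par q
      via lev-z (inj₁ q~z)   = q , ~-sym q~z , par-~ eq
      via lev-z (inj₂ par~T) = _ , par-~ lev-z , par~T
    ...   | _ , x~v , v~T | _ , y~w , w~T = no5Walk x~v v~T (~-sym w~T) (~-sym y~w) (~-sym x~y)

    -- One colour for the vertices near `q`, `m` for growing the trail, `m + 1` for the vertices of
    -- `B`, and 4 for `Kept`.
    colours : ℕ
    colours = 1 + (m + (suc m + 4))

    reach-colourable : ∀ q → ColourableOn (λ x → Reach (Above q) q x × Above q x) colours
    reach-colourable q = colourable-split (λ x → (q ~? x) ⊎-dec (par x ~? par q))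
      (stable⇒colourable λ x y ((_ , x∈K) , near-x) ((_ , y∈K) , near-y) → near-stable q x y x∈K y∈K near-x near-y)
      (colourable-⊆ (λ ((reach , x∈K) , far) → (reach , x∈K , far ∘ inj₂) , far ∘ inj₁)
        (extend (above? q) (λ x → ¬? (par x ~? par q)) q∉K λ q~v v∈K →
          trail-colourable m (∖N? (above? q) q) (trail q~v v∈K) refl))
      where
      q∉K : ¬ Above q q
      q∉K (eq , _) = 1+n≢n (sym eq)
      trail : ∀ {v} → q ~ v → Above q v → Trail q v (q ∷ []) (Above q ∖N q)
      trail q~v v∈K = record
        { q∈B     = here refl
        ; B-lev   = inj₂ refl ∷ []
        ; p-lev   = proj₁ v∈K
        ; p∉K     = λ (_ , q≁v) → q≁v q~v
        ; K-lev   = proj₁ ∘ proj₁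
        ; K-root  = proj₂ ∘ proj₁
        ; K-apart = λ (x∈K , q≁x) → ((λ { refl → q∉K x∈K }) , q≁x ∘ ~-sym) ∷ []
        ; induced = λ ind low → ~-sym q~v ,
            All-map (λ lev< → Apart-lev (subst (2 + lev _ ≤_) (sym (proj₁ v∈K)) (s≤s lev<))) low , ind
        }

    -- Every vertex is reached from its parent, and a `q` that reaches one vertex within the level
    -- reaches its neighbours there as well. Level 0 is stable, having one root per component.
    level-colourable : ∀ k → ColourableOn (λ x → lev x ≡ k) colours
    level-colourable zero = colourable-≤ (s≤s z≤n) (stable⇒colourable λ x y lev-x lev-y x~y →
      ~⇒≢ x~y (trans (sym (lev≡0⇒root lev-x)) (trans (root-~ x~y) (lev≡0⇒root lev-y))))
    level-colourable (suc k) = colourable-glue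
      {E = λ q x → Above q x × Reach (Above q) q x}
      (λ q x → above? q x ×-dec reach? (above? q) q x)
      (λ x → lev x ≟ℕ suc k)
      (λ x lev-x → par x , above-par lev-x , Reach-step Reach-refl (~-sym (par-~ lev-x)) (above-par lev-x))
      (λ lev-x lev-y x~y ((lev-q , root-q) , reach) →
        let y∈K = trans lev-y (trans (sym lev-x) lev-q) , trans root-q (root-~ x~y) in
        y∈K , Reach-step reach x~y y∈K)
      λ q → colourable-⊆ (λ ((x∈K , reach) , _) → reach , x∈K) (reach-colourable q)
      where
      above-par : ∀ {x} → lev x ≡ suc k → Above (par x) x
      above-par lev-x = trans lev-x (cong suc (sym (par-lev lev-x))) , sym (root-~ (par-~ lev-x))

    colourable : Colourable G (colours + colours)
    colourable = colourableOn⇒colourable _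
      (colourable-levels {X = λ _ → ⊤} lev (λ _ _ _ _ → lev-~) λ k → colourable-⊆ proj₂ (level-colourable k))

-- Breadth-first search.

levelling : ∀ {n} (G : Graph n) → Levelling G
levelling {n} G = record
  { lev        = lev
  ; par        = par
  ; root       = root
  ; lev-~      = λ {x} {y} x~y → Distance-~ (dist x) (subst (λ w → Distance Everything w (lev y) y) (sym (root-~ x~y)) (dist y)) x~y _
  ; par-~      = proj₁ ∘ par-spec
  ; par-lev    = proj₂ ∘ par-spec
  ; root-~     = root-~
  ; lev≡0⇒root = λ {x} eq → proj₁ (subst (λ i → Distance Everything (root x) i x) eq (dist x))
  }
  where
  open Graph G
  open Walks G

  Everything : Pred (Fin n) 0ℓ
  Everything _ = ⊤
  everything? : Decidable Everything
  everything? _ = yes _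

  -- The first vertex that reaches `x` is the same throughout a component.
  rooted : ∀ x → ∃ (IsFirst λ w → Reach Everything w x)
  rooted x = first (λ w → reach? everything? w x) (x , Reach-refl)
  root : Fin n → Fin n
  root x = proj₁ (rooted x)

  levelled : ∀ x → ∃[ t ] Distance Everything (root x) t x
  levelled x = distance everything? (proj₁ (proj₂ (rooted x)))
  lev : Fin n → ℕ
  lev x = proj₁ (levelled x)
  dist : ∀ x → Distance Everything (root x) (lev x) x
  dist x = proj₂ (levelled x)

  root-~ : ∀ {x y} → x ~ y → root x ≡ root y
  root-~ {x} {y} x~y = IsFirst-unique (λ r → Reach-step r x~y _) (λ r → Reach-step r (~-sym x~y) _)
    (proj₂ (rooted x)) (proj₂ (rooted y))

  predecessor? : ∀ x → Dec (∃[ y ] suc (lev y) ≡ lev x × x ~ y)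
  predecessor? x = any? λ y → (suc (lev y) ≟ℕ lev x) ×-dec (x ~? y)
  par : Fin n → Fin n
  -- At level 0 there is no predecessor and `x` is a dummy value.
  par x = pick x (predecessor? x)

  predecessor : ∀ {x k} → lev x ≡ suc k → ∃[ y ] suc (lev y) ≡ lev x × x ~ y
  predecessor {x} {k} eq =
    let y , dy , y~x = Distance-pred (subst (λ i → Distance Everything (root x) i x) eq (dist x)) in
    y , trans (cong suc (Distance-unique (dist y) (subst (λ w → Distance Everything w k y) (sym (root-~ y~x)) dy))) (sym eq) , ~-sym y~x

  par-spec : ∀ {x k} → lev x ≡ suc k → x ~ par x × lev (par x) ≡ k
  par-spec {x} eq =
    let lev-par , x~par = pick-spec x (predecessor? x) (predecessor eq) in
    x~par , suc-injective (trans lev-par eq)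

-- Arithmetic and the final bound.

parity≡1ℙ⇒odd : ∀ k → parity k ≡ 1ℙ → Odd k
parity≡1ℙ⇒odd k odd (divides i refl) with parity i | *-homo-* i 2
... | 0ℙ | even = contradiction (trans (sym odd) even) λ ()
... | 1ℙ | even = contradiction (trans (sym odd) even) λ ()

1+d≤4^d : ∀ d → suc d ≤ 4 ^ d
1+d≤4^d zero    = s≤s z≤n
1+d≤4^d (suc d) = begin
  suc (suc d)               ≤⟨ m≤m+n (suc (suc d)) (2 + 3 * d) ⟩
  suc (suc d) + (2 + 3 * d) ≡⟨ expand d ⟩
  4 * suc d                 ≤⟨ *-monoʳ-≤ 4 (1+d≤4^d d) ⟩
  4 * 4 ^ d                 ∎
  where
  open ≤-Reasoning
  expand : ∀ d → suc (suc d) + (2 + 3 * d) ≡ 4 * suc d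
  expand = solve-∀

-- Here `c` is `colours` for `m = 4 * d`. With `suc d` in place of `4 ^ d`, the right side exceeds
-- the left by exactly `4 * (d * d)`.
colours-≤ : ∀ d → let c = 1 + (4 * d + (suc (4 * d) + 4)) in c + c ≤ (2 + d + 1) * 4 ^ suc d
colours-≤ d = begin
  c + c                           ≤⟨ m≤m+n (c + c) (4 * (d * d)) ⟩
  c + c + 4 * (d * d)             ≡⟨ expand d ⟩
  (2 + d + 1) * (4 * suc d)       ≤⟨ *-monoʳ-≤ (2 + d + 1) (*-monoʳ-≤ 4 (1+d≤4^d d)) ⟩
  (2 + d + 1) * 4 ^ suc d         ∎
  where
  open ≤-Reasoning
  c = 1 + (4 * d + (suc (4 * d) + 4))
  expand : ∀ d → let c = 1 + (4 * d + (suc (4 * d) + 4)) in c + c + 4 * (d * d) ≡ (2 + d + 1) * (4 * suc d)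
  expand = solve-∀

-- For ℓ = 2 the bound is met with equality, by taking m = 0.
noLongOddHole : ∀ {n} (G : Graph n) d → ¬ Hole G 5 → (∀ k → Odd k → 2 * (2 + d) + 1 < k → ¬ Hole G k) →
  ∀ k → parity k ≡ 1ℙ → 4 * d + 4 ≤ k → ¬ Hole G k
noLongOddHole G zero no5 noLong 4 () _
noLongOddHole G zero no5 noLong 5 odd _ = no5
noLongOddHole G zero no5 noLong k@(suc (suc (suc (suc (suc (suc _)))))) odd _ =
  noLong k (parity≡1ℙ⇒odd k odd) (s≤s (s≤s (s≤s (s≤s (s≤s (s≤s z≤n))))))
noLongOddHole G zero no5 noLong 0 odd ()
noLongOddHole G zero no5 noLong 1 odd (s≤s ())
noLongOddHole G zero no5 noLong 2 odd (s≤s (s≤s ()))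
noLongOddHole G zero no5 noLong 3 odd (s≤s (s≤s (s≤s ())))
noLongOddHole G (suc d) no5 noLong k odd long = noLong k (parity≡1ℙ⇒odd k odd)
  (≤-trans (≤-trans (m≤m+n _ (2 * d)) (≤-reflexive (expand d))) long)
  where
  expand : ∀ d → suc (2 * (2 + suc d) + 1) + 2 * d ≡ 4 * suc d + 4
  expand = solve-∀

mainTheorem2 : ∀ (ℓ : ℕ) → 2 ≤ ℓ →
    ∀ (n : ℕ) (G : Graph n) →
    TriangleFree G →
    ¬ Hole G 5 →
    (∀ k → Odd k → 2 * ℓ + 1 < k → ¬ Hole G k) →
    χ G ≤ (ℓ + 1) * 4 ^ (ℓ ∸ 1)
mainTheorem2 (suc (suc d)) (s≤s (s≤s z≤n)) n G triangleFree no5 noLong =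
  -- With `m = 4 * d`, odd lengths from `m + 4` on exceed `2 * ℓ + 1` if `d` is positive; if `d` is
  -- 0, the only exception is 5.
  ≤-trans (proj₂ (χ-isLeast G) _ (Levels.colourable G (levelling G) triangleFree no5 (4 * d)
    (noLongOddHole G d no5 noLong))) (colours-≤ d)
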